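{- For each $n$-tuple $(S_1,\dots,S_n)$ of strings, there are $O(n\log n)$ interesting pairs, where the constant in $O(\cdot)$ is absolute (independent of the tuple and of the lengths of the strings).
   Context: For two strings $S,T$, $\mathrm{LCP}(S,T)$ denotes the length of their longest common prefix ($0$ if they have no nonempty common prefix). Given a tuple $(S_1,\dots,S_n)$ of strings, a pair $(i,j)$ with $i,j\in\{1,\dots,n\}$ is called interesting if $i<j$ and for every integer $\ell$ with $i+1\le\ell\le j-1$ one has $\mathrm{LCP}(S_i,S_\ell)<\mathrm{LCP}(S_i,S_j)$. -}

module Defs where

open import Data.Fin.Base using (Fin) renaming (_<_ to _<ᶠ_)
open import Data.Fin.Properties using (all?) renaming (_<?_ to _<ᶠ?_)
open import Data.List.Base using (List; []; _∷_; length; filter; allFin; cartesianProduct)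
open import Data.List.Relation.Binary.Prefix.Heterogeneous using (Prefix; []; _∷_)
open import Data.Nat.Base using (ℕ; _≤_; _<_; z≤n; s≤s)
open import Data.Nat.Properties using (_<?_)
open import Data.Product.Base using (_×_; _,_)
open import Data.Vec.Functional using (Vector)
open import Relation.Binary.Definitions using (DecidableEquality)
open import Relation.Binary.PropositionalEquality using (_≡_; refl; trans; sym)
open import Relation.Nullary using (Dec; yes; no; contradiction; _×-dec_; _→-dec_)

module _ {A : Set} (_≟_ : DecidableEquality A) where

  longestCommonPrefix : List A → List A → List A
  longestCommonPrefix []       _        = []
  longestCommonPrefix (_ ∷ _)  []       = []
  longestCommonPrefix (x ∷ xs) (y ∷ ys) with x ≟ y
  ... | yes _ = x ∷ longestCommonPrefix xs ys
  ... | no  _ = []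

  LCP : List A → List A → ℕ
  LCP s t = length (longestCommonPrefix s t)

  longestCommonPrefix-prefixˡ : ∀ s t → Prefix _≡_ (longestCommonPrefix s t) s
  longestCommonPrefix-prefixˡ []       _        = []
  longestCommonPrefix-prefixˡ (_ ∷ _)  []       = []
  longestCommonPrefix-prefixˡ (x ∷ xs) (y ∷ ys) with x ≟ y
  ... | yes _ = refl ∷ longestCommonPrefix-prefixˡ xs ys
  ... | no  _ = []

  longestCommonPrefix-prefixʳ : ∀ s t → Prefix _≡_ (longestCommonPrefix s t) t
  longestCommonPrefix-prefixʳ []       _        = []
  longestCommonPrefix-prefixʳ (_ ∷ _)  []       = []
  longestCommonPrefix-prefixʳ (x ∷ xs) (y ∷ ys) with x ≟ y
  ... | yes x≡y = x≡y ∷ longestCommonPrefix-prefixʳ xs ys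
  ... | no  _   = []

  LCP-longest : ∀ {p} s t → Prefix _≡_ p s → Prefix _≡_ p t → length p ≤ LCP s t
  LCP-longest _        _        []        _         = z≤n
  LCP-longest (x ∷ xs) (y ∷ ys) (p≡x ∷ u) (p≡y ∷ v) with x ≟ y
  ... | yes _   = s≤s (LCP-longest xs ys u v)
  ... | no  x≢y = contradiction (trans (sym p≡x) p≡y) x≢y

  module _ {n : ℕ} (S : Vector (List A) n) where

    Interesting : Fin n → Fin n → Set
    Interesting i j =
      i <ᶠ j × (∀ ℓ → i <ᶠ ℓ → ℓ <ᶠ j → LCP (S i) (S ℓ) < LCP (S i) (S j))

    interesting? : ∀ i j → Dec (Interesting i j)
    interesting? i j = (i <ᶠ? j) ×-dec
      all? (λ ℓ → (i <ᶠ? ℓ) →-dec ((ℓ <ᶠ? j) →-dec (LCP (S i) (S ℓ) <? LCP (S i) (S j))))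

    #interesting : ℕ
    #interesting =
      length (filter (λ (i , j) → interesting? i j) (cartesianProduct (allFin n) (allFin n)))

{-# OPTIONS --safe #-}
module Submission where

-- Charge an interesting pair (i , j) with LCP(S i , S j) = ℓ to whichever of
-- {i} ∪ {k : LCP(S i , S k) > ℓ} and {j} ∪ {k : LCP(S j , S k) > ℓ} is smaller.
-- These sets are disjoint and lie in a common cluster of similarity ≥ ℓ, so the
-- cluster around the charged index at least doubles between thresholds ℓ + 1 and ℓ.
-- The pairs charged to a fixed index as first (or as second) entry have distinct ℓ,
-- hence there are at most log₂ n of them, and at most 2 n log₂ n pairs overall.

open import Algebra.Properties.CommutativeSemigroup using (x∙yz≈y∙xz)
open import Defs
open import Data.Fin.Base using (Fin) renaming (_<_ to _<ᶠ_)
open import Data.Fin.Properties using (any?) renaming (_≟_ to _≟ᶠ_; <⇒≢ to <ᶠ⇒≢; <-cmp to <ᶠ-cmp)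
open import Data.List.Base
  using (List; []; _∷_; _++_; length; filter; map; allFin; cartesianProduct)
open import Data.List.Membership.Propositional.Properties using (∈-allFin; ∈-filter⁺; ∈-length)
open import Data.List.Properties
  using (cartesianProductWith-zeroʳ; filter-++; filter-none; length-++; length-filter; length-tabulate)
open import Data.List.Relation.Unary.All as All using (All)
open import Data.List.Relation.Unary.AllPairs using ([]; _∷_)
open import Data.List.Relation.Unary.Unique.Propositional using (Unique)
open import Data.List.Relation.Unary.Unique.Propositional.Properties using (allFin⁺)
open import Data.Nat.Base using (ℕ; zero; suc; _+_; _*_; _^_; _≤_; _<_; z≤n; s≤s)
open import Data.Nat.Logarithm using (⌊log₂_⌋; ⌊log₂⌋-mono-≤; ⌊log₂[2^n]⌋≡n)
open import Data.Nat.Properties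
open import Data.Product.Base using (∃-syntax; _×_; _,_; proj₁; proj₂)
open import Data.Sum.Base as Sum using (_⊎_; inj₁; inj₂)
open import Data.Vec.Functional using (Vector)
open import Function.Base using (_∘_; id)
open import Relation.Binary.Definitions using (DecidableEquality; tri<; tri≈; tri>)
open import Relation.Binary.PropositionalEquality
open import Relation.Nullary using (¬_; yes; no; contradiction; _×-dec_; _⊎-dec_)
open import Relation.Unary using (Decidable)

-- Counting list elements that satisfy a decidable predicate.

module _ {A : Set} where

  count : {P : A → Set} → Decidable P → List A → ℕ
  count P? xs = length (filter P? xs)

  module _ {P Q R : A → Set} (P? : Decidable P) (Q? : Decidable Q) (R? : Decidable R) where

    count-⊎ : (∀ {x} → P x → Q x ⊎ R x) → ∀ xs → count P? xs ≤ count Q? xs + count R? xs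
    count-⊎ P⇒Q⊎R [] = z≤n
    count-⊎ P⇒Q⊎R (x ∷ xs) with ih ← count-⊎ P⇒Q⊎R xs | P? x | Q? x | R? x
    ... | no  _ | no  _ | no  _ = ih
    ... | no  _ | no  _ | yes _ = ≤-trans ih (+-monoʳ-≤ _ (n≤1+n _))
    ... | no  _ | yes _ | no  _ = m≤n⇒m≤1+n ih
    ... | no  _ | yes _ | yes _ = m≤n⇒m≤1+n (≤-trans ih (+-monoʳ-≤ _ (n≤1+n _)))
    ... | yes p | no ¬q | no ¬r = contradiction (P⇒Q⊎R p) Sum.[ ¬q , ¬r ]
    ... | yes _ | no  _ | yes _ = ≤-trans (s≤s ih) (≤-reflexive (sym (+-suc _ _)))
    ... | yes _ | yes _ | no  _ = s≤s ih
    ... | yes _ | yes _ | yes _ = s≤s (≤-trans ih (+-monoʳ-≤ _ (n≤1+n _)))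

    count-disjoint : (∀ {x} → Q x → P x) → (∀ {x} → R x → P x) → (∀ {x} → Q x → ¬ R x) →
                     ∀ xs → count Q? xs + count R? xs ≤ count P? xs
    count-disjoint Q⇒P R⇒P Q⇒¬R [] = z≤n
    count-disjoint Q⇒P R⇒P Q⇒¬R (x ∷ xs)
      with ih ← count-disjoint Q⇒P R⇒P Q⇒¬R xs | P? x | Q? x | R? x
    ... | _     | yes q | yes r = contradiction r (Q⇒¬R q)
    ... | no ¬p | yes q | no  _ = contradiction (Q⇒P q) ¬p
    ... | no ¬p | no  _ | yes r = contradiction (R⇒P r) ¬p
    ... | no  _ | no  _ | no  _ = ih
    ... | yes _ | yes _ | no  _ = s≤s ih
    ... | yes _ | no  _ | yes _ = ≤-trans (≤-reflexive (+-suc _ _)) (s≤s ih)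
    ... | yes _ | no  _ | no  _ = m≤n⇒m≤1+n ih

  module _ {P Q : A → Set} (P? : Decidable P) (Q? : Decidable Q) where

    count-mono : (∀ {x} → P x → Q x) → ∀ xs → count P? xs ≤ count Q? xs
    count-mono P⇒Q [] = z≤n
    count-mono P⇒Q (x ∷ xs) with ih ← count-mono P⇒Q xs | P? x | Q? x
    ... | no  _ | no  _ = ih
    ... | no  _ | yes _ = m≤n⇒m≤1+n ih
    ... | yes p | no ¬q = contradiction (P⇒Q p) ¬q
    ... | yes _ | yes _ = s≤s ih

  module _ {P : A → Set} (P? : Decidable P) where

    count-none : ∀ {xs} → All (¬_ ∘ P) xs → count P? xs ≡ 0
    count-none = cong length ∘ filter-none P?

    count-subsingleton : (∀ {x y} → P x → P y → x ≡ y) → ∀ {xs} → Unique xs → count P? xs ≤ 1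
    count-subsingleton P-prop [] = z≤n
    count-subsingleton P-prop {x ∷ xs} (x∉xs ∷ xs!) with P? x
    ... | no  _  = count-subsingleton P-prop xs!
    ... | yes px = s≤s (≤-reflexive (count-none (All.map (λ x≢y py → x≢y (P-prop px py)) x∉xs)))

count-map : {A B : Set} {P : B → Set} (P? : Decidable P) (f : A → B) →
            ∀ xs → count P? (map f xs) ≡ count (P? ∘ f) xs
count-map P? f [] = refl
count-map P? f (x ∷ xs) with P? (f x)
... | no  _ = count-map P? f xs
... | yes _ = cong suc (count-map P? f xs)

-- Counting pairs by rows and by columns.

module _ {A B : Set} {P : A × B → Set} (P? : Decidable P) where

  open ≡-Reasoning

  private
    row : A → List B → ℕ
    row x = count (λ y → P? (x , y))

    column : B → List A → ℕ
    column y = count (λ x → P? (x , y))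

  count-row-++ : ∀ x ys zs → count P? (map (x ,_) ys ++ zs) ≡ row x ys + count P? zs
  count-row-++ x ys zs = begin
    count P? (map (x ,_) ys ++ zs)
      ≡⟨ cong length (filter-++ P? (map (x ,_) ys) zs) ⟩
    length (filter P? (map (x ,_) ys) ++ filter P? zs)
      ≡⟨ length-++ (filter P? (map (x ,_) ys)) ⟩
    count P? (map (x ,_) ys) + count P? zs
      ≡⟨ cong (_+ count P? zs) (count-map P? (x ,_) ys) ⟩
    row x ys + count P? zs ∎

  count-rows : ∀ {b} xs ys → (∀ x → row x ys ≤ b) →
               count P? (cartesianProduct xs ys) ≤ length xs * b
  count-rows []       ys row≤b = z≤n
  count-rows (x ∷ xs) ys row≤b =
    ≤-trans (≤-reflexive (count-row-++ x ys (cartesianProduct xs ys)))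
            (+-mono-≤ (row≤b x) (count-rows xs ys row≤b))

  -- `cartesianProduct` lists pairs row by row, so the entries of a column are scattered; each row
  -- in turn gives up its first entry to the column.
  count-column : ∀ xs y ys → count P? (cartesianProduct xs (y ∷ ys)) ≡
                 column y xs + count P? (cartesianProduct xs ys)
  count-column []       y ys = refl
  count-column (x ∷ xs) y ys
    -- `eq` is the claim without the corner pair `(x , y)`, which contributes equally to both sides
    -- once `P?` has decided it.
    with eq ← (begin
           count P? (map (x ,_) ys ++ cartesianProduct xs (y ∷ ys))
             ≡⟨ count-row-++ x ys (cartesianProduct xs (y ∷ ys)) ⟩
           row x ys + count P? (cartesianProduct xs (y ∷ ys))
             ≡⟨ cong (row x ys +_) (count-column xs y ys) ⟩
           row x ys + (column y xs + count P? (cartesianProduct xs ys))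
             ≡⟨ x∙yz≈y∙xz +-commutativeSemigroup (row x ys) (column y xs) _ ⟩
           column y xs + (row x ys + count P? (cartesianProduct xs ys))
             ≡⟨ cong (column y xs +_) (count-row-++ x ys (cartesianProduct xs ys)) ⟨
           column y xs + count P? (cartesianProduct (x ∷ xs) ys) ∎)
       | P? (x , y)
  ... | no  _ = eq
  ... | yes _ = cong suc eq

  count-columns : ∀ {b} xs ys → (∀ y → column y xs ≤ b) →
                  count P? (cartesianProduct xs ys) ≤ length ys * b
  count-columns xs []       col≤b =
    ≤-reflexive (cong (count P?) (cartesianProductWith-zeroʳ _,_ xs))
  count-columns xs (y ∷ ys) col≤b =
    ≤-trans (≤-reflexive (count-column xs y ys))
            (+-mono-≤ (col≤b y) (count-columns xs ys col≤b))

2^m≤n⇒m≤⌊log₂n⌋ : ∀ {m n} → 2 ^ m ≤ n → m ≤ ⌊log₂ n ⌋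
2^m≤n⇒m≤⌊log₂n⌋ {m} 2^m≤n = ≤-trans (≤-reflexive (sym (⌊log₂[2^n]⌋≡n m))) (⌊log₂⌋-mono-≤ 2^m≤n)

-- LCP as an ultrametric similarity.

module _ {A : Set} (_≟_ : DecidableEquality A) where

  LCP-comm-≤ : ∀ s t → LCP _≟_ s t ≤ LCP _≟_ t s
  LCP-comm-≤ s t = LCP-longest _≟_ t s (longestCommonPrefix-prefixʳ _≟_ s t)
                                       (longestCommonPrefix-prefixˡ _≟_ s t)

  LCP-comm : ∀ s t → LCP _≟_ s t ≡ LCP _≟_ t s
  LCP-comm s t = ≤-antisym (LCP-comm-≤ s t) (LCP-comm-≤ t s)

  -- A positive bound forces equal heads in both comparisons, so the heads of the outer strings
  -- agree by transitivity and the tails carry the bound lowered by one.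
  LCP-ultra : ∀ {m} s t u → m ≤ LCP _≟_ s t → m ≤ LCP _≟_ t u → m ≤ LCP _≟_ s u
  LCP-ultra {zero}  _ _ _ _ _ = z≤n
  LCP-ultra {suc m} (x ∷ s) (y ∷ t) (z ∷ u) p q with x ≟ y | y ≟ z | x ≟ z
  LCP-ultra {suc m} (x ∷ s) (y ∷ t) (z ∷ u) (s≤s p) (s≤s q)
      | yes _ | yes _ | yes _ = s≤s (LCP-ultra s t u p q)
  ... | yes x≡y | yes y≡z | no x≢z = contradiction (trans x≡y y≡z) x≢z

-- Clusters of an ultrametric similarity and their sizes.

module Similarity {n : ℕ} (d : Fin n → Fin n → ℕ) (d-comm : ∀ x y → d x y ≡ d y x)
  (d-ultra : ∀ {m} x y z → m ≤ d x y → m ≤ d y z → m ≤ d x z) where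

  -- The centre is included explicitly, since m may exceed d x x.
  Cluster : Fin n → ℕ → Fin n → Set
  Cluster x m k = k ≡ x ⊎ m ≤ d x k

  cluster? : ∀ x m → Decidable (Cluster x m)
  cluster? x m k = (k ≟ᶠ x) ⊎-dec (m ≤? d x k)

  size : Fin n → ℕ → ℕ
  size x m = count (cluster? x m) (allFin n)

  size-antitone : ∀ x m → size x (suc m) ≤ size x m
  size-antitone x m =
    count-mono (cluster? x (suc m)) (cluster? x m) (Sum.map₂ <⇒≤) (allFin n)

  1≤size : ∀ x m → 1 ≤ size x m
  1≤size x m = ∈-length (∈-filter⁺ (cluster? x m) (∈-allFin x) (inj₁ refl))

  size≤n : ∀ x m → size x m ≤ n
  size≤n x m = ≤-trans (length-filter (cluster? x m) (allFin n)) (≤-reflexive (length-tabulate id))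

  -- Going from `x` to `y` and back keeps the similarity. This caps the thresholds that matter for
  -- the centre `x`.
  d-self : ∀ x y → d x y ≤ d x x
  d-self x y = d-ultra x y x ≤-refl (≤-reflexive (d-comm x y))

  -- The ultrametric inequality puts both clusters inside the larger one, and a shared member other
  -- than the centres would push `d x y` above itself. If `d x y` equals both self-similarities, the
  -- two clusters are just their centres, and disjointness is `x ≢ y`.
  size-split : ∀ {x y} → x ≢ y → size x (suc (d x y)) + size y (suc (d x y)) ≤ size x (d x y)
  size-split {x} {y} x≢y =
    count-disjoint (cluster? x (d x y)) (cluster? x (suc (d x y))) (cluster? y (suc (d x y)))
      (Sum.map₂ <⇒≤) y-inside disjoint (allFin n)
    where
    y-inside : ∀ {k} → Cluster y (suc (d x y)) k → Cluster x (d x y) k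
    y-inside     (inj₁ refl) = inj₂ ≤-refl
    y-inside {k} (inj₂ d<)   = inj₂ (d-ultra x y k ≤-refl (<⇒≤ d<))

    disjoint : ∀ {k} → Cluster x (suc (d x y)) k → ¬ Cluster y (suc (d x y)) k
    disjoint     (inj₁ refl) (inj₁ refl) = x≢y refl
    disjoint     (inj₁ refl) (inj₂ d<)   = <-irrefl (d-comm x y) d<
    disjoint     (inj₂ d<)   (inj₁ refl) = <-irrefl refl d<
    disjoint {k} (inj₂ d<)   (inj₂ d<′)  =
      <-irrefl refl (d-ultra x k y d< (subst (d x y <_) (d-comm y k) d<′))

  size-double : ∀ {x y} → x ≢ y → size x (suc (d x y)) ≤ size y (suc (d x y)) →
                2 * size x (suc (d x y)) ≤ size x (d x y)
  size-double {x} {y} x≢y x≤y = begin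
    size x (suc (d x y)) + (size x (suc (d x y)) + 0) ≡⟨ cong (size x (suc (d x y)) +_) (+-identityʳ _) ⟩
    size x (suc (d x y)) + size x (suc (d x y))       ≤⟨ +-monoʳ-≤ _ x≤y ⟩
    size x (suc (d x y)) + size y (suc (d x y))       ≤⟨ size-split x≢y ⟩
    size x (d x y)                                    ∎
    where open ≤-Reasoning

  -- Logarithmic bound on the elements charged to one centre.

  module _ (x : Fin n) {P : Fin n → Set} (P? : Decidable P)
    (d-injective : ∀ {y z} → P y → P z → d x y ≡ d x z → y ≡ z)
    (lighter : ∀ {y} → P y → x ≢ y × size x (suc (d x y)) ≤ size y (suc (d x y))) where

    private
      above? : ∀ m → Decidable (λ y → P y × m ≤ d x y)
      above? m y = P? y ×-dec (m ≤? d x y)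

      at? : ∀ m → Decidable (λ y → P y × d x y ≡ m)
      at? m y = P? y ×-dec (d x y ≟ m)

      #above : ℕ → ℕ
      #above m = count (above? m) (allFin n)

      at⊎above : ∀ {m y} → P y × m ≤ d x y → (P y × d x y ≡ m) ⊎ (P y × suc m ≤ d x y)
      at⊎above (py , m≤d) = Sum.map (λ m≡d → py , sym m≡d) (py ,_) (Sum.swap (m≤n⇒m<n∨m≡n m≤d))

      -- By `d-injective`, at most one element of `P` has similarity exactly `m` to `x`.
      #above-suc : ∀ m → #above m ≤ 1 + #above (suc m)
      #above-suc m = ≤-trans
        (count-⊎ (above? m) (at? m) (above? (suc m)) at⊎above (allFin n))
        (+-monoˡ-≤ _ (count-subsingleton (at? m)
          (λ (py , dy) (pz , dz) → d-injective py pz (trans dy (sym dz))) (allFin⁺ n)))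

      -- The threshold `m` descends from above `d x x`, with `k` as the fuel for the recursion.
      -- Passing a level occupied by an element of `P` raises the exponent by at most one and at
      -- least doubles the cluster.
      2^#above≤size : ∀ k m → d x x < k + m → 2 ^ #above m ≤ size x m
      2^#above≤size zero m d<m = begin
        -- Beyond `d x x` no element is counted, while the cluster still contains its centre.
        2 ^ #above m ≡⟨ cong (2 ^_) (count-none (above? m) {allFin n} (All.tabulate λ {y} _ (_ , m≤d) →
                          <-irrefl refl (<-≤-trans d<m (≤-trans m≤d (d-self x y))))) ⟩
        1            ≤⟨ 1≤size x m ⟩
        size x m     ∎
        where open ≤-Reasoning
      2^#above≤size (suc k) m d<k+m
        with ih ← 2^#above≤size k (suc m) (subst (d x x <_) (sym (+-suc k m)) d<k+m)
           | any? (at? m)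
      -- Matching `refl` turns the threshold `m` into `d x y`, the level at which `size-double`
      -- speaks.
      ... | yes (y , py , refl) = begin
        2 ^ #above m             ≤⟨ ^-monoʳ-≤ 2 (#above-suc m) ⟩
        2 * 2 ^ #above (suc m)   ≤⟨ *-monoʳ-≤ 2 ih ⟩
        2 * size x (suc (d x y)) ≤⟨ size-double (proj₁ (lighter py)) (proj₂ (lighter py)) ⟩
        size x m                 ∎
        where open ≤-Reasoning
      ... | no none = begin
        2 ^ #above m       ≤⟨ ^-monoʳ-≤ 2 (count-mono (above? m) (above? (suc m))
                                (λ a → Sum.[ (λ at → contradiction (_ , at) none) , id ] (at⊎above a))
                                (allFin n)) ⟩
        2 ^ #above (suc m) ≤⟨ ih ⟩
        size x (suc m)     ≤⟨ size-antitone x m ⟩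
        size x m           ∎
        where open ≤-Reasoning

    count-lighter : count P? (allFin n) ≤ ⌊log₂ n ⌋
    count-lighter = 2^m≤n⇒m≤⌊log₂n⌋ (begin
      2 ^ count P? (allFin n) ≤⟨ ^-monoʳ-≤ 2 (count-mono P? (above? 0) (_, z≤n) (allFin n)) ⟩
      -- `suc (d x x)` is the least fuel that reaches threshold 0.
      2 ^ #above 0            ≤⟨ 2^#above≤size (suc (d x x)) 0 (≤-reflexive (sym (+-identityʳ _))) ⟩
      size x 0                ≤⟨ size≤n x 0 ⟩
      n                       ∎)
      where open ≤-Reasoning

-- Charging the interesting pairs.

module _ {A : Set} (_≟_ : DecidableEquality A) {n : ℕ} (S : Vector (List A) n) where

  private
    d : Fin n → Fin n → ℕ
    d i j = LCP _≟_ (S i) (S j)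

    d-comm : ∀ i j → d i j ≡ d j i
    d-comm i j = LCP-comm _≟_ (S i) (S j)

    d-ultra : ∀ {m} i j k → m ≤ d i j → m ≤ d j k → m ≤ d i k
    d-ultra i j k = LCP-ultra _≟_ (S i) (S j) (S k)

  open Similarity d d-comm d-ultra

  -- Each partner of `i` is a strict record of `d i`, so the later of two partners has the larger
  -- value.
  Interesting-injectiveˡ : ∀ {i j k} → Interesting _≟_ S i j → Interesting _≟_ S i k →
                           d i j ≡ d i k → j ≡ k
  Interesting-injectiveˡ {i} {j} {k} (i<j , j-record) (i<k , k-record) eq with <ᶠ-cmp j k
  ... | tri< j<k _ _ = contradiction (k-record j i<j j<k) (<-irrefl eq)
  ... | tri≈ _ j≡k _ = j≡k
  ... | tri> _ _ k<j = contradiction (j-record k i<k k<j) (<-irrefl (sym eq))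

  -- Since `i′` lies between `i` and `j`, the record at `j` gives `d i i′ < d i j`. Equal
  -- similarities to `j` would give `d i j ≤ d i i′` by the ultrametric inequality through `j`.
  Interesting-decreasing : ∀ {i i′ j} → i <ᶠ i′ → Interesting _≟_ S i j → Interesting _≟_ S i′ j →
                           d j i ≢ d j i′
  Interesting-decreasing {i} {i′} {j} i<i′ (_ , record-i) (i′<j , _) eq =
    <-irrefl refl (<-≤-trans (record-i i′ i<i′ i′<j)
      (d-ultra i j i′ ≤-refl (≤-reflexive (trans (d-comm i j) eq))))

  Interesting-injectiveʳ : ∀ {i i′ j} → Interesting _≟_ S i j → Interesting _≟_ S i′ j →
                           d j i ≡ d j i′ → i ≡ i′
  Interesting-injectiveʳ {i} {i′} p q eq with <ᶠ-cmp i i′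
  ... | tri< i<i′ _ _ = contradiction eq (Interesting-decreasing i<i′ p q)
  ... | tri≈ _ i≡i′ _ = i≡i′
  ... | tri> _ _ i′<i = contradiction (sym eq) (Interesting-decreasing i′<i q p)

  private
    -- The pair is charged to `i` in the first case and to `j` in the second. Writing `d j i` in the
    -- second puts the charged index first, as `count-lighter` expects of its centre.
    InterestingLighterˡ InterestingLighterʳ : Fin n × Fin n → Set
    InterestingLighterˡ (i , j) = Interesting _≟_ S i j × size i (suc (d i j)) ≤ size j (suc (d i j))
    InterestingLighterʳ (i , j) = Interesting _≟_ S i j × size j (suc (d j i)) ≤ size i (suc (d j i))

    lighterˡ? : Decidable InterestingLighterˡ
    lighterˡ? (i , j) = interesting? _≟_ S i j ×-dec (size i (suc (d i j)) ≤? size j (suc (d i j)))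

    lighterʳ? : Decidable InterestingLighterʳ
    lighterʳ? (i , j) = interesting? _≟_ S i j ×-dec (size j (suc (d j i)) ≤? size i (suc (d j i)))

    lighter-total : ∀ {i j} → Interesting _≟_ S i j →
                    InterestingLighterˡ (i , j) ⊎ InterestingLighterʳ (i , j)
    lighter-total {i} {j} p = Sum.map (p ,_)
      (λ j≤i → p , subst (λ m → size j (suc m) ≤ size i (suc m)) (d-comm i j) j≤i)
      (≤-total (size i (suc (d i j))) (size j (suc (d i j))))

  #interesting-bound : #interesting _≟_ S ≤ 2 * (n * ⌊log₂ n ⌋)
  #interesting-bound = begin
    #interesting _≟_ S
      ≤⟨ count-⊎ (λ (i , j) → interesting? _≟_ S i j) lighterˡ? lighterʳ? lighter-total pairs ⟩
    count lighterˡ? pairs + count lighterʳ? pairs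
      -- Pairs charged to their first entry are counted by rows, those charged to their second by
      -- columns; each family contributes one `n * ⌊log₂ n ⌋`, whence the constant 2.
      ≤⟨ +-mono-≤ (count-rows lighterˡ? (allFin n) (allFin n) λ i →
                     count-lighter i (λ j → lighterˡ? (i , j))
                       (λ (p , _) (q , _) → Interesting-injectiveˡ p q)
                       (λ ((i<j , _) , l) → <ᶠ⇒≢ i<j , l))
                  (count-columns lighterʳ? (allFin n) (allFin n) λ j →
                     count-lighter j (λ i → lighterʳ? (i , j))
                       (λ (p , _) (q , _) → Interesting-injectiveʳ p q)
                       (λ ((i<j , _) , l) → <ᶠ⇒≢ i<j ∘ sym , l)) ⟩
    length (allFin n) * ⌊log₂ n ⌋ + length (allFin n) * ⌊log₂ n ⌋
      ≡⟨ cong (λ k → k * ⌊log₂ n ⌋ + k * ⌊log₂ n ⌋) (length-tabulate {n = n} id) ⟩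
    n * ⌊log₂ n ⌋ + n * ⌊log₂ n ⌋
      ≡⟨ cong (n * ⌊log₂ n ⌋ +_) (+-identityʳ _) ⟨
    2 * (n * ⌊log₂ n ⌋) ∎
    where
    open ≤-Reasoning
    pairs = cartesianProduct (allFin n) (allFin n)

lemma19 : ∃[ C ] (∀ (A : Set) (_≟_ : DecidableEquality A) (n : ℕ) (S : Vector (List A) n) → #interesting _≟_ S ≤ C * (n * ⌊log₂ n ⌋))
lemma19 = 2 , λ A _≟_ n S → #interesting-bound _≟_ S
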